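{- Let $n$ be a positive integer. For a Dyck path $P$ of length $2n$, let $a(P)$ denote the number of up-steps that $P$ takes before its first down-step, and let $b(P)$ denote the number of positive integers $x\le 2n$ for which $\mathrm{ht}_P(x)=0$. Then the Tutte polynomial of the Catalan matroid $\mathbf{C}_n$ is equal to $$T_{\mathbf{C}_n}(q,t)=\sum_{P\ \mathrm{Dyck}} q^{a(P)}t^{b(P)},$$ where the sum is over all Dyck paths of length $2n$.
   Context: A Dyck path of length $2n$ is a path in the plane from $(0,0)$ to $(2n,0)$, with steps $(1,1)$ (up-steps) and $(1,-1)$ (down-steps), that never passes below the $x$-axis. $\mathrm{ht}_P(x)$ denotes the height of the path $P$ after its first $x$ steps. The up-step set of a path is the set of $i\in[2n]=\{1,\dots,2n\}$ for which the $i$-th step is an up-step. The Catalan matroid $\mathbf{C}_n$ is the matroid on the ground set $[2n]$ whose bases are the up-step sets of all Dyck paths of length $2n$. The Tutte polynomial of a matroid $M$ on a ground set $S$ with rank function $\mathrm{r}$ is $T_M(q,t)=\sum_{A\subseteq S}(q-1)^{\mathrm{r}(S)-\mathrm{r}(A)}(t-1)^{|A|-\mathrm{r}(A)}$. -}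

module Defs where

open import Algebra.Bundles using (CommutativeRing)
import Algebra.Properties.Ring as RingProperties
import Algebra.Properties.Semiring.Exp as Exp
open import Data.Fin.Base as Fin using (Fin; zero; suc; fromℕ)
import Data.Fin.Properties as Fin
open import Data.Fin.Subset
  using (Subset; Side; inside; outside; _∈_; _∉_; _⊆_; _∪_; ⁅_⁆; ∣_∣; ⊤)
  renaming (_-_ to _∖_)
open import Data.Fin.Subset.Properties using (_⊆?_; anySubset?; p─⊥≡p; ∪-identityʳ)
open import Data.Integer.Base as ℤ using (ℤ; 0ℤ; 1ℤ; -1ℤ; +_)
import Data.Integer.Properties as ℤ
open import Data.Integer.Tactic.RingSolver using (solve-∀)
open import Data.List.Base as List using (List; []; _∷_)
open import Data.List.Extrema.Nat using (max)
open import Data.Nat.Base as ℕ using (ℕ; zero; suc; _∸_)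
import Data.Nat.Properties as ℕ
open import Data.Product.Base using (∃; _×_; _,_)
open import Data.Sum.Base using (_⊎_; inj₁; inj₂; [_,_]′)
open import Data.Vec.Base as Vec using (Vec; []; _∷_; _[_]=_; here; there; _[_]≔_)
import Data.Vec.Properties as Vec
open import Level using (Level; 0ℓ)
open import Relation.Binary.PropositionalEquality
  using (_≡_; refl; sym; trans; cong; subst)
import Relation.Binary.Reasoning.Setoid as SetoidReasoning
open import Relation.Nullary using (contradiction)
open import Relation.Nullary.Decidable as Dec using (_×-dec_)
open import Relation.Unary using (Decidable)

module Polynomial {c ℓ : Level} (R : CommutativeRing c ℓ) where

  open CommutativeRing R hiding (zero)
  open RingProperties ring using (-0#≈0#)

  -- Coefficients in order of increasing degree; trailing zeros are allowed,
  -- and equality compares coefficients.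
  Poly : Set c
  Poly = List Carrier

  coeff : Poly → ℕ → Carrier
  coeff []      _       = 0#
  coeff (a ∷ p) zero    = a
  coeff (a ∷ p) (suc i) = coeff p i

  infix 4 _≈ₚ_
  record _≈ₚ_ (p r : Poly) : Set ℓ where
    constructor mk≈
    field coeff-≈ : ∀ i → coeff p i ≈ coeff r i
  open _≈ₚ_ public

  infixl 6 _+ₚ_
  infixl 7 _*ₚ_ _·_
  infix  8 -ₚ_

  _+ₚ_ : Poly → Poly → Poly
  []      +ₚ r       = r
  (a ∷ p) +ₚ []      = a ∷ p
  (a ∷ p) +ₚ (b ∷ r) = (a + b) ∷ (p +ₚ r)

  -ₚ_ : Poly → Poly
  -ₚ_ = List.map (-_)

  _·_ : Carrier → Poly → Poly
  a · p = List.map (a *_) p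

  _*ₚ_ : Poly → Poly → Poly
  []      *ₚ r = []
  (a ∷ p) *ₚ r = a · r +ₚ (0# ∷ (p *ₚ r))

  const : Carrier → Poly
  const a = a ∷ []

  X : Poly
  X = 0# ∷ 1# ∷ []

  private
    ≈-refl : ∀ {p} → p ≈ₚ p
    ≈-refl = mk≈ λ _ → CommutativeRing.refl R

    ≈-sym : ∀ {p r} → p ≈ₚ r → r ≈ₚ p
    ≈-sym e = mk≈ λ i → CommutativeRing.sym R (coeff-≈ e i)

    ≈-trans : ∀ {p r s} → p ≈ₚ r → r ≈ₚ s → p ≈ₚ s
    ≈-trans e f = mk≈ λ i → CommutativeRing.trans R (coeff-≈ e i) (coeff-≈ f i)

    ∷-cong : ∀ {a b p r} → a ≈ b → p ≈ₚ r → (a ∷ p) ≈ₚ (b ∷ r)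
    ∷-cong e f = mk≈ λ { zero → e ; (suc i) → coeff-≈ f i }

    0∷[] : (0# ∷ []) ≈ₚ []
    0∷[] = mk≈ λ { zero → CommutativeRing.refl R ; (suc i) → CommutativeRing.refl R }

    coeff-+ : ∀ p r i → coeff (p +ₚ r) i ≈ coeff p i + coeff r i
    coeff-+ []      r       i       = CommutativeRing.sym R (+-identityˡ _)
    coeff-+ (a ∷ p) []      i       = CommutativeRing.sym R (+-identityʳ _)
    coeff-+ (a ∷ p) (b ∷ r) zero    = CommutativeRing.refl R
    coeff-+ (a ∷ p) (b ∷ r) (suc i) = coeff-+ p r i

    coeff-neg : ∀ p i → coeff (-ₚ p) i ≈ - coeff p i
    coeff-neg []      i       = CommutativeRing.sym R -0#≈0#
    coeff-neg (a ∷ p) zero    = CommutativeRing.refl R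
    coeff-neg (a ∷ p) (suc i) = coeff-neg p i

    coeff-· : ∀ a p i → coeff (a · p) i ≈ a * coeff p i
    coeff-· a []      i       = CommutativeRing.sym R (zeroʳ a)
    coeff-· a (b ∷ p) zero    = CommutativeRing.refl R
    coeff-· a (b ∷ p) (suc i) = coeff-· a p i

    open SetoidReasoning setoid

    +-congₚ : ∀ {p p′ r r′} → p ≈ₚ p′ → r ≈ₚ r′ → p +ₚ r ≈ₚ p′ +ₚ r′
    +-congₚ {p} {p′} {r} {r′} e f = mk≈ λ i → begin
      coeff (p +ₚ r) i         ≈⟨ coeff-+ p r i ⟩
      coeff p i + coeff r i    ≈⟨ +-cong (coeff-≈ e i) (coeff-≈ f i) ⟩
      coeff p′ i + coeff r′ i  ≈⟨ coeff-+ p′ r′ i ⟨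
      coeff (p′ +ₚ r′) i       ∎

    +-assocₚ : ∀ p r s → (p +ₚ r) +ₚ s ≈ₚ p +ₚ (r +ₚ s)
    +-assocₚ p r s = mk≈ λ i → begin
      coeff ((p +ₚ r) +ₚ s) i                ≈⟨ coeff-+ (p +ₚ r) s i ⟩
      coeff (p +ₚ r) i + coeff s i           ≈⟨ +-congʳ (coeff-+ p r i) ⟩
      (coeff p i + coeff r i) + coeff s i    ≈⟨ +-assoc _ _ _ ⟩
      coeff p i + (coeff r i + coeff s i)    ≈⟨ +-congˡ (coeff-+ r s i) ⟨
      coeff p i + coeff (r +ₚ s) i           ≈⟨ coeff-+ p (r +ₚ s) i ⟨
      coeff (p +ₚ (r +ₚ s)) i                ∎

    +-commₚ : ∀ p r → p +ₚ r ≈ₚ r +ₚ p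
    +-commₚ p r = mk≈ λ i → begin
      coeff (p +ₚ r) i       ≈⟨ coeff-+ p r i ⟩
      coeff p i + coeff r i  ≈⟨ +-comm _ _ ⟩
      coeff r i + coeff p i  ≈⟨ coeff-+ r p i ⟨
      coeff (r +ₚ p) i       ∎

    +-identityʳₚ : ∀ p → p +ₚ [] ≈ₚ p
    +-identityʳₚ p = +-commₚ p []

    -‿congₚ : ∀ {p r} → p ≈ₚ r → -ₚ p ≈ₚ -ₚ r
    -‿congₚ {p} {r} e = mk≈ λ i → begin
      coeff (-ₚ p) i  ≈⟨ coeff-neg p i ⟩
      - coeff p i     ≈⟨ -‿cong (coeff-≈ e i) ⟩
      - coeff r i     ≈⟨ coeff-neg r i ⟨
      coeff (-ₚ r) i  ∎

    -‿inverseˡₚ : ∀ p → -ₚ p +ₚ p ≈ₚ []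
    -‿inverseˡₚ p = mk≈ λ i → begin
      coeff (-ₚ p +ₚ p) i         ≈⟨ coeff-+ (-ₚ p) p i ⟩
      coeff (-ₚ p) i + coeff p i  ≈⟨ +-congʳ (coeff-neg p i) ⟩
      - coeff p i + coeff p i     ≈⟨ -‿inverseˡ _ ⟩
      0#                          ∎

    ·-cong : ∀ {a b p r} → a ≈ b → p ≈ₚ r → a · p ≈ₚ b · r
    ·-cong {a} {b} {p} {r} e f = mk≈ λ i → begin
      coeff (a · p) i  ≈⟨ coeff-· a p i ⟩
      a * coeff p i    ≈⟨ *-cong e (coeff-≈ f i) ⟩
      b * coeff r i    ≈⟨ coeff-· b r i ⟨
      coeff (b · r) i  ∎

    ·-distribˡ : ∀ a p r → a · (p +ₚ r) ≈ₚ a · p +ₚ a · r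
    ·-distribˡ a p r = mk≈ λ i → begin
      coeff (a · (p +ₚ r)) i             ≈⟨ coeff-· a (p +ₚ r) i ⟩
      a * coeff (p +ₚ r) i               ≈⟨ *-congˡ (coeff-+ p r i) ⟩
      a * (coeff p i + coeff r i)        ≈⟨ distribˡ _ _ _ ⟩
      a * coeff p i + a * coeff r i      ≈⟨ +-cong (coeff-· a p i) (coeff-· a r i) ⟨
      coeff (a · p) i + coeff (a · r) i  ≈⟨ coeff-+ (a · p) (a · r) i ⟨
      coeff (a · p +ₚ a · r) i           ∎

    ·-assoc : ∀ a b p → (a * b) · p ≈ₚ a · (b · p)
    ·-assoc a b p = mk≈ λ i → begin
      coeff ((a * b) · p) i  ≈⟨ coeff-· (a * b) p i ⟩
      (a * b) * coeff p i    ≈⟨ *-assoc _ _ _ ⟩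
      a * (b * coeff p i)    ≈⟨ *-congˡ (coeff-· b p i) ⟨
      a * coeff (b · p) i    ≈⟨ coeff-· a (b · p) i ⟨
      coeff (a · (b · p)) i  ∎

    0· : ∀ p → 0# · p ≈ₚ []
    0· p = mk≈ λ i → CommutativeRing.trans R (coeff-· 0# p i) (zeroˡ _)

    1· : ∀ p → 1# · p ≈ₚ p
    1· p = mk≈ λ i → CommutativeRing.trans R (coeff-· 1# p i) (*-identityˡ _)

    *-zeroʳₚ : ∀ p → p *ₚ [] ≈ₚ []
    *-zeroʳₚ []      = ≈-refl
    *-zeroʳₚ (a ∷ p) = ≈-trans (∷-cong (CommutativeRing.refl R) (*-zeroʳₚ p)) 0∷[]

    +-interchange : ∀ p r s u → (p +ₚ r) +ₚ (s +ₚ u) ≈ₚ (p +ₚ s) +ₚ (r +ₚ u)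
    +-interchange p r s u =
      ≈-trans (+-assocₚ p r (s +ₚ u))
      (≈-trans (+-congₚ (≈-refl {p})
        (≈-trans (≈-sym (+-assocₚ r s u))
        (≈-trans (+-congₚ (+-commₚ r s) (≈-refl {u})) (+-assocₚ s r u))))
      (≈-sym (+-assocₚ p s (r +ₚ u))))

    0∷-+ : ∀ p r → (0# ∷ (p +ₚ r)) ≈ₚ (0# ∷ p) +ₚ (0# ∷ r)
    0∷-+ p r = ∷-cong (CommutativeRing.sym R (+-identityˡ 0#)) ≈-refl

    *-∷ʳ : ∀ p b r → p *ₚ (b ∷ r) ≈ₚ b · p +ₚ (0# ∷ (p *ₚ r))
    *-∷ʳ []      b r = ≈-sym 0∷[]
    *-∷ʳ (a ∷ p) b r = ∷-cong (+-congʳ (*-comm a b))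
      (≈-trans (+-congₚ (≈-refl {a · r}) (*-∷ʳ p b r))
      (≈-trans (≈-sym (+-assocₚ (a · r) (b · p) _))
      (≈-trans (+-congₚ (+-commₚ (a · r) (b · p)) ≈-refl)
               (+-assocₚ (b · p) (a · r) _))))

    *-commₚ : ∀ p r → p *ₚ r ≈ₚ r *ₚ p
    *-commₚ []      r = ≈-sym (*-zeroʳₚ r)
    *-commₚ (a ∷ p) r =
      ≈-trans (+-congₚ (≈-refl {a · r}) (∷-cong (CommutativeRing.refl R) (*-commₚ p r)))
              (≈-sym (*-∷ʳ r a p))

    *-congʳₚ : ∀ p {r s} → r ≈ₚ s → p *ₚ r ≈ₚ p *ₚ s
    *-congʳₚ []      e = ≈-refl
    *-congʳₚ (a ∷ p) e = +-congₚ (·-cong (CommutativeRing.refl R) e)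
                                 (∷-cong (CommutativeRing.refl R) (*-congʳₚ p e))

    *-congₚ : ∀ {p p′ r r′} → p ≈ₚ p′ → r ≈ₚ r′ → p *ₚ r ≈ₚ p′ *ₚ r′
    *-congₚ {p} {p′} {r} {r′} e f =
      ≈-trans (*-congʳₚ p f)
      (≈-trans (*-commₚ p r′) (≈-trans (*-congʳₚ r′ e) (*-commₚ r′ p′)))

    *-distribˡₚ : ∀ p r s → p *ₚ (r +ₚ s) ≈ₚ p *ₚ r +ₚ p *ₚ s
    *-distribˡₚ []      r s = ≈-refl
    *-distribˡₚ (a ∷ p) r s =
      ≈-trans (+-congₚ (·-distribˡ a r s)
        (≈-trans (∷-cong (CommutativeRing.refl R) (*-distribˡₚ p r s))
                 (0∷-+ (p *ₚ r) (p *ₚ s))))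
      (+-interchange (a · r) (a · s) (0# ∷ (p *ₚ r)) (0# ∷ (p *ₚ s)))

    *-distribʳₚ : ∀ p r s → (r +ₚ s) *ₚ p ≈ₚ r *ₚ p +ₚ s *ₚ p
    *-distribʳₚ p r s =
      ≈-trans (*-commₚ (r +ₚ s) p)
      (≈-trans (*-distribˡₚ p r s) (+-congₚ (*-commₚ p r) (*-commₚ p s)))

    ·-*-assoc : ∀ a r s → (a · r) *ₚ s ≈ₚ a · (r *ₚ s)
    ·-*-assoc a []      s = ≈-refl
    ·-*-assoc a (b ∷ r) s =
      ≈-trans (+-congₚ (·-assoc a b s)
        (∷-cong (CommutativeRing.sym R (zeroʳ a)) (·-*-assoc a r s)))
      (≈-sym (·-distribˡ a (b · s) (0# ∷ (r *ₚ s))))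

    *-assocₚ : ∀ p r s → (p *ₚ r) *ₚ s ≈ₚ p *ₚ (r *ₚ s)
    *-assocₚ []      r s = ≈-refl
    *-assocₚ (a ∷ p) r s =
      ≈-trans (*-distribʳₚ s (a · r) (0# ∷ (p *ₚ r)))
      (+-congₚ (·-*-assoc a r s)
        (≈-trans (+-congₚ (0· s) ≈-refl)
                 (∷-cong (CommutativeRing.refl R) (*-assocₚ p r s))))

    *-identityˡₚ : ∀ p → const 1# *ₚ p ≈ₚ p
    *-identityˡₚ p = ≈-trans (+-congₚ (1· p) 0∷[]) (+-identityʳₚ p)

  polynomialRing : CommutativeRing c ℓ
  polynomialRing = record
    { Carrier = Poly
    ; _≈_     = _≈ₚ_
    ; _+_     = _+ₚ_
    ; _*_     = _*ₚ_
    ; -_      = -ₚ_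
    ; 0#      = []
    ; 1#      = const 1#
    ; isCommutativeRing = record
      { isRing = record
        { +-isAbelianGroup = record
          { isGroup = record
            { isMonoid = record
              { isSemigroup = record
                { isMagma = record
                  { isEquivalence = record
                    { refl = ≈-refl ; sym = ≈-sym ; trans = ≈-trans }
                  ; ∙-cong = +-congₚ
                  }
                ; assoc = +-assocₚ
                }
              ; identity = (λ _ → ≈-refl) , +-identityʳₚ
              }
            ; inverse = -‿inverseˡₚ
                      , λ p → ≈-trans (+-commₚ p (-ₚ p)) (-‿inverseˡₚ p)
            ; ⁻¹-cong = -‿congₚ
            }
          ; comm = +-commₚ
          }
        ; *-cong     = *-congₚ
        ; *-assoc    = *-assocₚ
        ; *-identity = *-identityˡₚ
                     , λ p → ≈-trans (*-commₚ p (const 1#)) (*-identityˡₚ p)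
        ; distrib    = *-distribˡₚ , *-distribʳₚ
        }
      ; *-comm = *-commₚ
      }
    }

-- ℤ[q,t], as polynomials in t over ℤ[q].
ℤ[q] : CommutativeRing 0ℓ 0ℓ
ℤ[q] = Polynomial.polynomialRing ℤ.+-*-commutativeRing

ℤ[q,t] : CommutativeRing 0ℓ 0ℓ
ℤ[q,t] = Polynomial.polynomialRing ℤ[q]

module ℤ[q,t] where
  open CommutativeRing ℤ[q,t] public
    using (Carrier; _≈_; _+_; _*_; _-_; 0#; 1#)
  open Exp (CommutativeRing.semiring ℤ[q,t]) public using (_^_)

  q t : Carrier
  q = Polynomial.const ℤ[q] (Polynomial.X ℤ.+-*-commutativeRing)
  t = Polynomial.X ℤ[q]

  ∑ : ∀ {i} {I : Set i} → List I → (I → Carrier) → Carrier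
  ∑ xs f = List.foldr (λ x s → f x + s) 0# xs

-- All vectors with entries from xs, each listed once if xs has no repeats.
vectors : ∀ {A : Set} → List A → ∀ m → List (Vec A m)
vectors xs zero    = [] ∷ []
vectors xs (suc m) = List.cartesianProductWith _∷_ xs (vectors xs m)

subsets : ∀ m → List (Subset m)
subsets = vectors (outside ∷ inside ∷ [])

record Matroid (m : ℕ) : Set₁ where
  field
    IsBasis      : Subset m → Set
    isBasis?     : Decidable IsBasis
    basis-exists : ∃ IsBasis
    exchange     : ∀ {A B} → IsBasis A → IsBasis B →
                   ∀ {x} → x ∈ A → x ∉ B →
                   ∃ λ y → y ∈ B × y ∉ A × IsBasis ((A ∖ x) ∪ ⁅ y ⁆)

  Independent : Subset m → Set
  Independent I = ∃ λ B → IsBasis B × I ⊆ B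

  independent? : Decidable Independent
  independent? I = anySubset? λ B → isBasis? B ×-dec (I ⊆? B)

  rank : Subset m → ℕ
  rank A = max 0 (List.map ∣_∣
    (List.filter (λ I → (I ⊆? A) ×-dec independent? I) (subsets m)))

-- The truncated subtractions are exact, as rank A ≤ rank ⊤ and rank A ≤ ∣ A ∣.
tutte : ∀ {m} → Matroid m → ℤ[q,t].Carrier
tutte {m} M = ∑ (subsets m) λ A →
  (q - 1#) ^ (rank ⊤ ∸ rank A) * (t - 1#) ^ (∣ A ∣ ∸ rank A)
  where
  open ℤ[q,t]
  open Matroid M

data Step : Set where
  up down : Step

Path : ℕ → Set
Path = Vec Step

rise : Step → ℤ
rise up   = 1ℤ
rise down = -1ℤ

-- Height after the first x steps, 0 ≤ x ≤ m.
ht : ∀ {m} → Path m → Fin (suc m) → ℤ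
ht P       zero    = 0ℤ
ht (s ∷ P) (suc x) = rise s ℤ.+ ht P x

IsDyck : ∀ {m} → Path m → Set
IsDyck {m} P = (∀ x → 0ℤ ℤ.≤ ht P x) × ht P (fromℕ m) ≡ 0ℤ

isDyck? : ∀ {m} → Decidable (IsDyck {m})
isDyck? {m} P = Fin.all? (λ x → 0ℤ ℤ.≤? ht P x) ×-dec (ht P (fromℕ m) ℤ.≟ 0ℤ)

dyckPaths : ∀ m → List (Path m)
dyckPaths m = List.filter isDyck? (vectors (up ∷ down ∷ []) m)

a : ∀ {m} → Path m → ℕ
a []         = 0
a (up ∷ P)   = suc (a P)
a (down ∷ P) = 0

-- The number of x with 1 ≤ x ≤ m and height 0; i : Fin m stands for x = i + 1.
b : ∀ {m} → Path m → ℕ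
b {m} P = List.length (List.filter (λ i → ht P (suc i) ℤ.≟ 0ℤ) (List.allFin m))

side : Step → Side
side up   = inside
side down = outside

-- The i-th step of the path corresponds to i - 1 : Fin m.
upSteps : ∀ {m} → Path m → Subset m
upSteps = Vec.map side

IsUpStepSet : ∀ {m} → Subset m → Set
IsUpStepSet B = ∃ λ P → IsDyck P × upSteps P ≡ B

private
  step : Side → Step
  step inside  = up
  step outside = down

  step-side : ∀ {m} (P : Path m) → Vec.map step (upSteps P) ≡ P
  step-side []         = refl
  step-side (up ∷ P)   = cong (up ∷_) (step-side P)
  step-side (down ∷ P) = cong (down ∷_) (step-side P)

  side-step : ∀ {m} (B : Subset m) → upSteps (Vec.map step B) ≡ B
  side-step []            = refl
  side-step (inside ∷ B)  = cong (inside ∷_) (side-step B)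
  side-step (outside ∷ B) = cong (outside ∷_) (side-step B)

  isUpStepSet? : ∀ {m} → Decidable (IsUpStepSet {m})
  isUpStepSet? B = Dec.map′
    (λ d → Vec.map step B , d , side-step B)
    (λ { (P , d , refl) → subst IsDyck (sym (step-side P)) d })
    (isDyck? (Vec.map step B))

  shift : ∀ j x → (1ℤ ℤ.+ j) ℤ.+ (-1ℤ ℤ.+ x) ≡ j ℤ.+ x
  shift = solve-∀

  shift′ : ∀ j x → j ℤ.+ (1ℤ ℤ.+ x) ≡ (1ℤ ℤ.+ j) ℤ.+ x
  shift′ = solve-∀

  downs-≥0 : ∀ k x → 0ℤ ℤ.≤ + k ℤ.+ ht (Vec.replicate k down) x
  downs-≥0 k       zero    = ℤ.+≤+ ℕ.z≤n
  downs-≥0 (suc k) (suc x) =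
    subst (0ℤ ℤ.≤_) (sym (shift (+ k) (ht (Vec.replicate k down) x))) (downs-≥0 k x)

  downs-end : ∀ k → + k ℤ.+ ht (Vec.replicate k down) (fromℕ k) ≡ 0ℤ
  downs-end zero    = refl
  downs-end (suc k) = trans (shift (+ k) (ht (Vec.replicate k down) (fromℕ k))) (downs-end k)

  ups-≥0 : ∀ n j {k} (P : Path k) → (∀ x → 0ℤ ℤ.≤ + (n ℕ.+ j) ℤ.+ ht P x) →
           ∀ x → 0ℤ ℤ.≤ + j ℤ.+ ht (Vec.replicate n up Vec.++ P) x
  ups-≥0 zero    j P h x       = h x
  ups-≥0 (suc n) j P h zero    = ℤ.+≤+ ℕ.z≤n
  ups-≥0 (suc n) j P h (suc x) = subst (0ℤ ℤ.≤_) (sym (shift′ (+ j) (ht (Vec.replicate n up Vec.++ P) x)))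
    (ups-≥0 n (suc j) P
      (λ y → subst (λ l → 0ℤ ℤ.≤ + l ℤ.+ ht P y) (sym (ℕ.+-suc n j)) (h y)) x)

  ups-end : ∀ n j {k} (P : Path k) → + (n ℕ.+ j) ℤ.+ ht P (fromℕ k) ≡ 0ℤ →
            + j ℤ.+ ht (Vec.replicate n up Vec.++ P) (fromℕ (n ℕ.+ k)) ≡ 0ℤ
  ups-end zero    j P h = h
  ups-end (suc n) j {k} P h = trans (shift′ (+ j) (ht (Vec.replicate n up Vec.++ P) (fromℕ (n ℕ.+ k))))
    (ups-end n (suc j) P
      (trans (cong (λ l → + l ℤ.+ ht P (fromℕ k)) (ℕ.+-suc n j)) h))

  mountain : ∀ n → Path (2 ℕ.* n)
  mountain n = Vec.replicate n up Vec.++ Vec.replicate (n ℕ.+ 0) down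

  mountain-dyck : ∀ n → IsDyck (mountain n)
  mountain-dyck n =
    (λ x → subst (0ℤ ℤ.≤_) (ℤ.+-identityˡ _)
             (ups-≥0 n 0 _ (downs-≥0 (n ℕ.+ 0)) x)) ,
    trans (sym (ℤ.+-identityˡ _)) (ups-end n 0 _ (downs-end (n ℕ.+ 0)))

  -- Basis exchange: exchanging x for the least y ∈ B ∖ A works.

  variable
    m : ℕ

  total : Path m → ℤ
  total {m} P = ht P (fromℕ m)

  raise : ∀ x → 1ℤ ℤ.+ x ≡ (-1ℤ ℤ.+ x) ℤ.+ (+ 2)
  raise = solve-∀

  assoc₂ : ∀ s x → s ℤ.+ (x ℤ.+ + 2) ≡ (s ℤ.+ x) ℤ.+ + 2
  assoc₂ = solve-∀

  down-up : ∀ x → -1ℤ ℤ.+ (x ℤ.+ + 2) ≡ 1ℤ ℤ.+ x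
  down-up = solve-∀

  rise-mono : ∀ {x y} s → x ℤ.≤ y → rise s ℤ.+ x ℤ.≤ rise s ℤ.+ y
  rise-mono s = ℤ.+-monoʳ-≤ (rise s)

  rise-mono-< : ∀ {x y} s → x ℤ.< y → rise s ℤ.+ x ℤ.< rise s ℤ.+ y
  rise-mono-< s = ℤ.+-monoʳ-< (rise s)

  cancel-≤ : ∀ s {x y} → rise s ℤ.+ x ℤ.≤ rise s ℤ.+ y → x ℤ.≤ y
  cancel-≤ s h = ℤ.≮⇒≥ λ y<x → ℤ.<⇒≱ (rise-mono-< s y<x) h

  cancel-< : ∀ s {x y} → rise s ℤ.+ x ℤ.< rise s ℤ.+ y → x ℤ.< y
  cancel-< s {x} {y} h = ℤ.≰⇒> λ y≤x → ℤ.<⇒≱ h (rise-mono s y≤x)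

  down≤up : ∀ x → -1ℤ ℤ.+ x ℤ.≤ 1ℤ ℤ.+ x
  down≤up x = ℤ.+-monoˡ-≤ x ℤ.-≤+

  down<up : ∀ x → -1ℤ ℤ.+ x ℤ.< 1ℤ ℤ.+ x
  down<up x = ℤ.+-monoˡ-< x ℤ.-<+

  data Heads : Step → Step → Set where
    new : Heads down up
    old : ∀ {s u} → (∀ x → rise u ℤ.+ x ℤ.≤ rise s ℤ.+ x) → Heads s u

  heads : ∀ s u → Heads s u
  heads down up   = new
  heads up   up   = old λ _ → ℤ.≤-refl
  heads up   down = old down≤up
  heads down down = old λ _ → ℤ.≤-refl

  total-tail-≤ : ∀ s u {x y} → (∀ z → rise u ℤ.+ z ℤ.≤ rise s ℤ.+ z) →
                 rise s ℤ.+ x ℤ.≤ rise u ℤ.+ y → x ℤ.≤ y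
  total-tail-≤ s u f h = cancel-≤ s (ℤ.≤-trans h (f _))

  total-tail-< : ∀ s u {x y} → (∀ z → rise u ℤ.+ z ℤ.≤ rise s ℤ.+ z) →
                 rise s ℤ.+ x ℤ.< rise u ℤ.+ y → x ℤ.< y
  total-tail-< s u f h = cancel-< s (ℤ.<-≤-trans h (f _))

  add-least : (P Q : Path m) → total P ℤ.< total Q →
    ∃ λ y → P [ y ]= down × Q [ y ]= up
          × (∀ i → ht P i ℤ.+ + 2 ℤ.≤ ht (P [ y ]≔ up) i
                 ⊎ ht Q i ℤ.≤ ht (P [ y ]≔ up) i)
          × total (P [ y ]≔ up) ≡ total P ℤ.+ + 2
  add-least []      []      h = contradiction h (ℤ.<-irrefl refl)
  add-least (s ∷ P) (u ∷ Q) h with heads s u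
  ... | new   = zero , here , here
              , (λ { zero    → inj₂ ℤ.≤-refl
                   ; (suc i) → inj₁ (ℤ.≤-reflexive (sym (raise (ht P i)))) })
              , raise (total P)
  ... | old f with add-least P Q (total-tail-< s u f h)
  ...   | y , P[y] , Q[y] , above , end =
                suc y , there P[y] , there Q[y]
              , (λ { zero    → inj₂ ℤ.≤-refl
                   ; (suc i) → [ (λ g → inj₁ (ℤ.≤-trans
                                   (ℤ.≤-reflexive (sym (assoc₂ (rise s) (ht P i))))
                                   (rise-mono s g)))
                               , (λ g → inj₂ (ℤ.≤-trans (f _) (rise-mono s g)))
                               ]′ (above i) })
              , trans (cong (λ v → rise s ℤ.+ v) end) (assoc₂ (rise s) (total P))

  drop : (P : Path m) (x : Fin m) → P [ x ]= up →
         total (P [ x ]≔ down) ℤ.+ + 2 ≡ total P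
         × (∀ i → ht P i ℤ.≤ ht (P [ x ]≔ down) i ℤ.+ + 2)
  drop (up ∷ P) zero here =
      sym (raise (total P))
    , λ { zero → ℤ.+≤+ ℕ.z≤n ; (suc i) → ℤ.≤-reflexive (raise (ht P i)) }
  drop (s ∷ P) (suc x) (there P[x]) with drop P x P[x]
  ... | end , above =
      trans (sym (assoc₂ (rise s) (total (P [ x ]≔ down)))) (cong (λ v → rise s ℤ.+ v) end)
    , λ { zero    → ℤ.+≤+ ℕ.z≤n
        ; (suc i) → ℤ.≤-trans (rise-mono s (above i)) (ℤ.≤-reflexive (assoc₂ (rise s) (ht (P [ x ]≔ down) i))) }

  swap : (P Q : Path m) (x : Fin m) → P [ x ]= up → Q [ x ]= down →
    total P ℤ.≤ total Q →
    ∃ λ y → P [ y ]= down × Q [ y ]= up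
          × (∀ i → ht P i ℤ.≤ ht (P [ x ]≔ down [ y ]≔ up) i
                 ⊎ ht Q i ℤ.≤ ht (P [ x ]≔ down [ y ]≔ up) i)
          × total (P [ x ]≔ down [ y ]≔ up) ≡ total P
  swap (up ∷ P) (down ∷ Q) zero here here h
    with add-least P Q (ℤ.≰⇒> λ g → ℤ.<⇒≱ (down<up (total P))
           (ℤ.≤-trans h (ℤ.+-monoʳ-≤ -1ℤ g)))
  ... | y , P[y] , Q[y] , above , end =
      suc y , there P[y] , there Q[y]
    , (λ { zero    → inj₁ ℤ.≤-refl
         ; (suc i) → [ (λ g → inj₁ (ℤ.≤-trans (ℤ.≤-reflexive (sym (down-up (ht P i))))
                                              (rise-mono down g)))
                     , (λ g → inj₂ (rise-mono down g)) ]′ (above i) })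
    , trans (cong (λ v → -1ℤ ℤ.+ v) end) (down-up (total P))
  swap (s ∷ P) (u ∷ Q) (suc x) (there P[x]) (there Q[x]) h with heads s u
  ... | new with drop P x P[x]
  ...   | end , above =
      zero , here , here
    , (λ { zero    → inj₁ ℤ.≤-refl
         ; (suc i) → inj₁ (ℤ.≤-trans (rise-mono down (above i))
                                     (ℤ.≤-reflexive (down-up (ht (P [ x ]≔ down) i)))) })
    , trans (sym (down-up (total (P [ x ]≔ down)))) (cong (λ v → -1ℤ ℤ.+ v) end)
  swap (s ∷ P) (u ∷ Q) (suc x) (there P[x]) (there Q[x]) h
      | old f with swap P Q x P[x] Q[x] (total-tail-≤ s u f h)
  ...   | y , P[y] , Q[y] , above , end =
      suc y , there P[y] , there Q[y]
    , (λ { zero    → inj₁ ℤ.≤-refl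
         ; (suc i) → [ (λ g → inj₁ (rise-mono s g))
                     , (λ g → inj₂ (ℤ.≤-trans (f _) (rise-mono s g))) ]′ (above i) })
    , cong (λ v → rise s ℤ.+ v) end

  ∈-up : (P : Path m) {x : Fin m} → x ∈ upSteps P → P [ x ]= up
  ∈-up (up ∷ P)   here      = here
  ∈-up (s ∷ P)    (there h) = there (∈-up P h)

  ∉-down : (P : Path m) {x : Fin m} → x ∉ upSteps P → P [ x ]= down
  ∉-down (up ∷ P)   {zero}  h = contradiction here h
  ∉-down (down ∷ P) {zero}  h = here
  ∉-down (s ∷ P)    {suc x} h = there (∉-down P (λ g → h (there g)))

  up-∈ : {P : Path m} {x : Fin m} → P [ x ]= up → x ∈ upSteps P
  up-∈ here      = here
  up-∈ (there h) = there (up-∈ h)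

  down-∉ : {P : Path m} {x : Fin m} → P [ x ]= down → x ∉ upSteps P
  down-∉ (there h) (there g) = down-∉ h g

  remove-≔ : (A : Subset m) (x : Fin m) → A ∖ x ≡ A [ x ]≔ outside
  remove-≔ (s ∷ A) zero    = cong (outside ∷_) (p─⊥≡p A)
  remove-≔ (s ∷ A) (suc x) = cong (s ∷_) (remove-≔ A x)

  insert-≔ : (A : Subset m) (x : Fin m) → A ∪ ⁅ x ⁆ ≡ A [ x ]≔ inside
  insert-≔ (inside  ∷ A) zero    = cong (inside ∷_) (∪-identityʳ A)
  insert-≔ (outside ∷ A) zero    = cong (inside ∷_) (∪-identityʳ A)
  insert-≔ (inside  ∷ A) (suc x) = cong (inside ∷_) (insert-≔ A x)
  insert-≔ (outside ∷ A) (suc x) = cong (outside ∷_) (insert-≔ A x)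

  upSteps-swap : (P : Path m) (x y : Fin m) →
    upSteps (P [ x ]≔ down [ y ]≔ up) ≡ (upSteps P ∖ x) ∪ ⁅ y ⁆
  upSteps-swap P x y =
    trans (Vec.map-[]≔ side (P [ x ]≔ down) y)
    (trans (cong (_[ y ]≔ inside) (trans (Vec.map-[]≔ side P x) (sym (remove-≔ (upSteps P) x))))
           (sym (insert-≔ (upSteps P ∖ x) y)))

  upSteps-exchange : {A B : Subset m} → IsUpStepSet A → IsUpStepSet B →
    ∀ {x} → x ∈ A → x ∉ B →
    ∃ λ y → y ∈ B × y ∉ A × IsUpStepSet ((A ∖ x) ∪ ⁅ y ⁆)
  upSteps-exchange (P , (P≥0 , P-end) , refl) (Q , (Q≥0 , Q-end) , refl) {x} x∈A x∉B
    with swap P Q x (∈-up P x∈A) (∉-down Q x∉B) (ℤ.≤-reflexive (trans P-end (sym Q-end)))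
  ... | y , P[y] , Q[y] , above , end =
      y , up-∈ Q[y] , down-∉ P[y]
    , P [ x ]≔ down [ y ]≔ up
    , ((λ i → [ ℤ.≤-trans (P≥0 i) , ℤ.≤-trans (Q≥0 i) ]′ (above i)) , trans end P-end)
    , upSteps-swap P x y

catalanMatroid : ∀ n → Matroid (2 ℕ.* n)
catalanMatroid n = record
  { IsBasis      = IsUpStepSet
  ; isBasis?     = isUpStepSet?
  ; basis-exists = upSteps (mountain n) , mountain n , mountain-dyck n , refl
  ; exchange     = upSteps-exchange
  }

{-# OPTIONS --safe #-}

-- Scan a set A ⊆ [2n] from the right, reading outside as a down-step, and keep
-- an element unless the steps read so far have surplus (downs minus kept ups)
-- zero, in which case it too becomes a down-step. The kept elements form a
-- maximal independent subset of A: the rejected ones number |A| − r(A), and the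
-- final surplus is 2 (n − r(A)). Summing (t − 1)^rejections over all A with a
-- given surplus, step by step, yields the generating function of paths counted
-- by returns to height 0: at surplus 0 the options outside and inside combine to
-- 1 + (t − 1) = t. Let F_m(h) be this sum over length m and surplus h, and
-- S_m(h) = Σ_j (q − 1)^j F_m(h + 2j). Then S_{m+1}(h) = q S_m(h + 1) plus the
-- contribution F_m(h − 1) (times t if h = 1), and this is the recurrence, by
-- first step, for paths from height h to 0 weighted by q^a t^b.

module Submission where

open import Defs
open import Algebra.Bundles using (CommutativeRing)
import Algebra.Properties.CommutativeSemigroup as CommutativeSemigroupProperties
import Algebra.Properties.Group as GroupProperties
import Algebra.Properties.Semiring.Exp as Exp
open import Data.Fin.Base using (Fin; zero; suc; fromℕ)
open import Data.Fin.Subset using (Subset; inside; outside; _⊆_; ∣_∣; ⊤)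
open import Data.Fin.Subset.Properties
  using (⊆⊤; drop-∷-⊆; out⊆; s⊆s; p⊆q⇒∣p∣≤∣q∣; _⊆?_)
open import Data.Integer.Base as ℤ using (ℤ; 0ℤ; 1ℤ; -1ℤ; +_)
import Data.Integer.Properties as ℤ
open import Data.Integer.Tactic.RingSolver using (solve-∀)
open import Data.List.Base as List using (List; []; _∷_; _++_)
open import Data.List.Extrema.Nat using (max≤v⁺; xs≤max)
open import Data.List.Membership.Propositional using () renaming (_∈_ to _∈ˡ_)
open import Data.List.Membership.Propositional.Properties
  using (∈-map⁺; ∈-map⁻; ∈-filter⁺; ∈-filter⁻; ∈-cartesianProductWith⁺)
import Data.List.Properties as List
import Data.List.Relation.Unary.All as All
open import Data.List.Relation.Unary.Any using (here; there)
open import Data.Nat.Base as ℕ using (ℕ; zero; suc; _∸_; NonZero)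
import Data.Nat.Properties as ℕ
import Data.Nat.Tactic.RingSolver as ℕ-Solver
open import Data.Product.Base using (∃; _×_; _,_)
open import Data.Vec.Base using (Vec; []; _∷_; here)
open import Function.Base using (_∘_; id)
open import Level using (Level)
open import Relation.Binary.PropositionalEquality as ≡ using (_≡_; _≢_; _≗_)
import Relation.Binary.Reasoning.Setoid as SetoidReasoning
open import Relation.Nullary using (¬_; contradiction; yes; no)
open import Relation.Nullary.Decidable using (_×-dec_)
open import Relation.Unary using (Pred; Decidable)

private
  variable
    m h : ℕ

-- Dyck suffixes

-- In terms of suffixes: each has at least as many down-steps as up-steps, and P
-- itself has h more.
data DyckFrom : ℕ → Path m → Set where
  []   : DyckFrom 0 []
  up   : {P : Path m} → DyckFrom (suc h) P → DyckFrom h (up ∷ P)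
  down : {P : Path m} → DyckFrom h P → DyckFrom (suc h) (down ∷ P)

ascend : ∀ j x → j ℤ.+ (1ℤ ℤ.+ x) ≡ (1ℤ ℤ.+ j) ℤ.+ x
ascend = solve-∀

fall : ∀ j x → (1ℤ ℤ.+ j) ℤ.+ (-1ℤ ℤ.+ x) ≡ j ℤ.+ x
fall = solve-∀

-- The starting height is a parameter because reading a step changes the height at which the
-- remaining path starts.
fromHeights : ∀ h (P : Path m) → (∀ x → 0ℤ ℤ.≤ + h ℤ.+ ht P x) →
              + h ℤ.+ ht P (fromℕ m) ≡ 0ℤ → DyckFrom h P
fromHeights zero    []         ≥0 end = []
fromHeights h       (up ∷ P)   ≥0 end = up (fromHeights (suc h) P
  (λ x → ≡.subst (0ℤ ℤ.≤_) (ascend (+ h) (ht P x)) (≥0 (suc x)))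
  (≡.trans (≡.sym (ascend (+ h) (ht P (fromℕ _)))) end))
fromHeights zero    (down ∷ P) ≥0 end = contradiction (≥0 (suc zero)) λ ()
fromHeights (suc h) (down ∷ P) ≥0 end = down (fromHeights h P
  (λ x → ≡.subst (0ℤ ℤ.≤_) (fall (+ h) (ht P x)) (≥0 (suc x)))
  (≡.trans (≡.sym (fall (+ h) (ht P (fromℕ _)))) end))

heights-≥0 : {P : Path m} → DyckFrom h P → ∀ x → 0ℤ ℤ.≤ + h ℤ.+ ht P x
heights-≥0 d                        zero    = ℤ.+≤+ ℕ.z≤n
heights-≥0 {h = h} (up {P = P} d)   (suc x) =
  ≡.subst (0ℤ ℤ.≤_) (≡.sym (ascend (+ h) (ht P x))) (heights-≥0 d x)
heights-≥0 (down {h = h} {P = P} d) (suc x) =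
  ≡.subst (0ℤ ℤ.≤_) (≡.sym (fall (+ h) (ht P x))) (heights-≥0 d x)

height-end : {P : Path m} → DyckFrom h P → + h ℤ.+ ht P (fromℕ m) ≡ 0ℤ
height-end []                       = ≡.refl
height-end {h = h} (up {P = P} d)   = ≡.trans (ascend (+ h) (ht P (fromℕ _))) (height-end d)
height-end (down {h = h} {P = P} d) = ≡.trans (fall (+ h) (ht P (fromℕ _))) (height-end d)

IsDyck⇒DyckFrom : {P : Path m} → IsDyck P → DyckFrom 0 P
IsDyck⇒DyckFrom {P = P} (≥0 , end) = fromHeights 0 P
  (λ x → ≡.subst (0ℤ ℤ.≤_) (≡.sym (ℤ.+-identityˡ (ht P x))) (≥0 x))
  (≡.trans (ℤ.+-identityˡ _) end)

DyckFrom⇒IsDyck : {P : Path m} → DyckFrom 0 P → IsDyck P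
DyckFrom⇒IsDyck {P = P} d =
    (λ x → ≡.subst (0ℤ ℤ.≤_) (ℤ.+-identityˡ (ht P x)) (heights-≥0 d x))
  , ≡.trans (≡.sym (ℤ.+-identityˡ _)) (height-end d)

DyckFrom-tail : ∀ {s} {P : Path m} → DyckFrom h (s ∷ P) → ∃ λ k → DyckFrom k P
DyckFrom-tail (up d)   = _ , d
DyckFrom-tail (down d) = _ , d

-- Down-steps exceed up-steps by `h`, and the two kinds together make up the length.
DyckFrom-size : {P : Path m} → DyckFrom h P → h ℕ.+ (∣ upSteps P ∣ ℕ.+ ∣ upSteps P ∣) ≡ m
DyckFrom-size []       = ≡.refl
DyckFrom-size (down d) = ≡.cong suc (DyckFrom-size d)
DyckFrom-size {h = h} (up {P = P} d) =
  ≡.trans (shift h ∣ upSteps P ∣) (≡.cong suc (DyckFrom-size d))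
  where
  shift : ∀ h r → h ℕ.+ (suc r ℕ.+ suc r) ≡ suc (suc h ℕ.+ (r ℕ.+ r))
  shift = ℕ-Solver.solve-∀

-- Turn the first k down-steps into up-steps.
fill : ∀ k {P : Path m} → DyckFrom (k ℕ.+ (k ℕ.+ h)) P →
       ∃ λ Q → DyckFrom h Q × upSteps P ⊆ upSteps Q
fill zero {P} d = P , d , id
fill {h = h} (suc k) (up {P = P} d)
  with fill {h = suc h} (suc k) (≡.subst (λ j → DyckFrom (suc j) P) (double-suc k h) d)
  where
  double-suc : ∀ k h → suc (k ℕ.+ suc (k ℕ.+ h)) ≡ k ℕ.+ suc (k ℕ.+ suc h)
  double-suc = ℕ-Solver.solve-∀
... | Q , e , P⊆Q = up ∷ Q , up e , s⊆s P⊆Q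
fill {h = h} (suc k) (down {P = P} d)
  -- From heights `2 (k + 1) + h` and `h`, the old path goes down and the new one up, which shrinks
  -- the gap between them to `2 k`.
  with fill {h = suc h} k (≡.subst (λ j → DyckFrom (k ℕ.+ j) P) (≡.sym (ℕ.+-suc k h)) d)
... | Q , e , P⊆Q = up ∷ Q , up e , out⊆ P⊆Q

-- The rank function

afterInside : ℕ → ℕ
afterInside zero    = 1
afterInside (suc h) = h

-- The scan from the right is recursion on the tail: the head is read last.
surplus : Subset m → ℕ
surplus []            = 0
surplus (outside ∷ A) = suc (surplus A)
surplus (inside ∷ A)  = afterInside (surplus A)

rejected : ℕ → ℕ
rejected zero    = 1
rejected (suc h) = 0

nullity : Subset m → ℕ
nullity []            = 0
nullity (outside ∷ A) = nullity A
nullity (inside ∷ A)  = rejected (surplus A) ℕ.+ nullity A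

keep : ℕ → Step
keep zero    = down
keep (suc h) = up

greedy : Subset m → Path m
greedy []            = []
greedy (outside ∷ A) = down ∷ greedy A
greedy (inside ∷ A)  = keep (surplus A) ∷ greedy A

greedyRank : Subset m → ℕ
greedyRank A = ∣ upSteps (greedy A) ∣

-- An element is kept only at positive surplus, so every kept up-step is matched by a later
-- down-step, and the surplus serves as height.
greedy-dyck : (A : Subset m) → DyckFrom (surplus A) (greedy A)
greedy-dyck []            = []
greedy-dyck (outside ∷ A) = down (greedy-dyck A)
greedy-dyck (inside ∷ A) with surplus A | greedy-dyck A
... | zero  | d = down d
... | suc k | d = up d

greedy-⊆ : (A : Subset m) → upSteps (greedy A) ⊆ A
greedy-⊆ []            = id
greedy-⊆ (outside ∷ A) = s⊆s (greedy-⊆ A)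
greedy-⊆ (inside ∷ A) with surplus A
... | zero  = out⊆ (greedy-⊆ A)
... | suc k = s⊆s (greedy-⊆ A)

greedyRank+nullity : (A : Subset m) → greedyRank A ℕ.+ nullity A ≡ ∣ A ∣
greedyRank+nullity []            = ≡.refl
greedyRank+nullity (outside ∷ A) = greedyRank+nullity A
greedyRank+nullity (inside ∷ A) with surplus A
... | zero  = ≡.trans (ℕ.+-suc _ _) (≡.cong suc (greedyRank+nullity A))
... | suc k = ≡.cong suc (greedyRank+nullity A)

-- Parity: `i + i` is even, so it cannot equal `suc (r + r)`. The slack of one allows for suffixes
-- of odd length.
halve-≤ : ∀ {i r} → i ℕ.+ i ℕ.≤ suc (r ℕ.+ r) → i ℕ.≤ r
halve-≤ {i} {r} h = ℕ.≮⇒≥ λ r<i → ℕ.<-irrefl ≡.refl (begin-strict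
  suc (r ℕ.+ r)    <⟨ ℕ.n<1+n _ ⟩
  2 ℕ.+ (r ℕ.+ r)  ≡⟨ ≡.cong suc (ℕ.+-suc r r) ⟨
  suc r ℕ.+ suc r  ≤⟨ ℕ.+-mono-≤ r<i r<i ⟩
  i ℕ.+ i          ≤⟨ h ⟩
  suc (r ℕ.+ r)    ∎)
  where open ℕ.≤-Reasoning

-- A rejected element ends a suffix of odd length 2 r + 1, of which r elements
-- are kept, and no Dyck path has more than r up-steps on that suffix.
greedy-maximal : (I A : Subset m) {Q : Path m} → DyckFrom h Q → I ⊆ A → I ⊆ upSteps Q →
                 ∣ I ∣ ℕ.≤ greedyRank A
greedy-maximal []            []            d I⊆A I⊆Q = ℕ.z≤n
greedy-maximal (inside ∷ I)  (outside ∷ A) d I⊆A I⊆Q = contradiction (I⊆A here) λ ()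
greedy-maximal (outside ∷ I) (outside ∷ A) {s ∷ Q} d I⊆A I⊆Q with DyckFrom-tail d
... | _ , e = greedy-maximal I A e (drop-∷-⊆ I⊆A) (drop-∷-⊆ I⊆Q)
greedy-maximal {suc m} {h} (i ∷ I) (inside ∷ A) {s ∷ Q} d I⊆A I⊆Q
  with surplus A | DyckFrom-size (greedy-dyck A) | DyckFrom-tail d
... | zero  | size | _ = halve-≤ (begin
  ∣ i ∷ I ∣ ℕ.+ ∣ i ∷ I ∣                              ≤⟨ ℕ.+-mono-≤ I≤Q I≤Q ⟩
  ∣ upSteps (s ∷ Q) ∣ ℕ.+ ∣ upSteps (s ∷ Q) ∣          ≤⟨ ℕ.m≤n+m _ h ⟩
  h ℕ.+ (∣ upSteps (s ∷ Q) ∣ ℕ.+ ∣ upSteps (s ∷ Q) ∣)  ≡⟨ DyckFrom-size d ⟩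
  suc m                                                ≡⟨ ≡.cong suc size ⟨
  suc (greedyRank A ℕ.+ greedyRank A)                  ∎)
  where
  open ℕ.≤-Reasoning
  I≤Q : ∣ i ∷ I ∣ ℕ.≤ ∣ upSteps (s ∷ Q) ∣
  I≤Q = p⊆q⇒∣p∣≤∣q∣ I⊆Q
-- The head is kept, so it counts once in the greedy rank and at most once in the size of `i ∷ I`.
... | suc k | _ | _ , e = ℕ.≤-trans (∣∷∣≤ i I)
  (ℕ.s≤s (greedy-maximal I A e (drop-∷-⊆ I⊆A) (drop-∷-⊆ I⊆Q)))
  where
  ∣∷∣≤ : ∀ i (I : Subset m) → ∣ i ∷ I ∣ ℕ.≤ suc ∣ I ∣
  ∣∷∣≤ outside I = ℕ.n≤1+n _
  ∣∷∣≤ inside  I = ℕ.≤-refl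

subsets-complete : (A : Subset m) → A ∈ˡ subsets m
subsets-complete []      = here ≡.refl
subsets-complete (s ∷ A) = ∈-cartesianProductWith⁺ _∷_ (sides s) (subsets-complete A)
  where
  sides : ∀ s → s ∈ˡ (outside ∷ inside ∷ [])
  sides outside = here ≡.refl
  sides inside  = there (here ≡.refl)

module _ {m : ℕ} (M : Matroid m) where

  open Matroid M

  rank-greatest : ∀ {A r} → (∀ {I} → I ⊆ A → Independent I → ∣ I ∣ ℕ.≤ r) → rank A ℕ.≤ r
  -- `ℕ.z≤n` bounds the default value `0` of `max`.
  rank-greatest {A} {r} bound = max≤v⁺ ℕ.z≤n (All.tabulate sizes)
    where
    I? = λ I → (I ⊆? A) ×-dec independent? I
    sizes : ∀ {k} → k ∈ˡ List.map ∣_∣ (List.filter I? (subsets m)) → k ℕ.≤ r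
    sizes k∈ with ∈-map⁻ ∣_∣ k∈
    ... | I , I∈ , ≡.refl with ∈-filter⁻ I? {xs = subsets m} I∈
    ...   | _ , I⊆A , ind = bound I⊆A ind

  independent⇒≤rank : ∀ {A I} → I ⊆ A → Independent I → ∣ I ∣ ℕ.≤ rank A
  independent⇒≤rank {A} {I} I⊆A ind = All.lookup (xs≤max 0 _)
    (∈-map⁺ ∣_∣ (∈-filter⁺ (λ I → (I ⊆? A) ×-dec independent? I)
      (subsets-complete I) (I⊆A , ind)))

module _ (n : ℕ) where

  open Matroid (catalanMatroid n)

  -- The length `2 n` is the surplus plus twice the greedy rank, so the surplus is even, with half
  -- `n - greedyRank A`.
  even-surplus : (A : Subset (2 ℕ.* n)) →
                 ∃ λ k → greedyRank A ℕ.+ k ≡ n × surplus A ≡ k ℕ.+ k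
  even-surplus A with ℕ.m≤n⇒∃[o]m+o≡n r≤n
    where
    size : surplus A ℕ.+ (greedyRank A ℕ.+ greedyRank A) ≡ 2 ℕ.* n
    size = DyckFrom-size (greedy-dyck A)
    r≤n : greedyRank A ℕ.≤ n
    r≤n = halve-≤ (begin
      greedyRank A ℕ.+ greedyRank A                      ≤⟨ ℕ.m≤n+m _ (surplus A) ⟩
      surplus A ℕ.+ (greedyRank A ℕ.+ greedyRank A)      ≡⟨ size ⟩
      n ℕ.+ (n ℕ.+ 0)                                    ≡⟨ ≡.cong (n ℕ.+_) (ℕ.+-identityʳ n) ⟩
      n ℕ.+ n                                            ≤⟨ ℕ.n≤1+n _ ⟩
      suc (n ℕ.+ n)                                      ∎)
      where open ℕ.≤-Reasoning
  ... | k , r+k≡n = k , r+k≡n , ℕ.+-cancelʳ-≡ (greedyRank A ℕ.+ greedyRank A) _ _ (begin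
    surplus A ℕ.+ (greedyRank A ℕ.+ greedyRank A)  ≡⟨ DyckFrom-size (greedy-dyck A) ⟩
    2 ℕ.* n                                        ≡⟨ ≡.cong (2 ℕ.*_) r+k≡n ⟨
    2 ℕ.* (greedyRank A ℕ.+ k)                     ≡⟨ rearrange (greedyRank A) k ⟩
    (k ℕ.+ k) ℕ.+ (greedyRank A ℕ.+ greedyRank A)  ∎)
    where
    open ≡.≡-Reasoning
    rearrange : ∀ r k → 2 ℕ.* (r ℕ.+ k) ≡ (k ℕ.+ k) ℕ.+ (r ℕ.+ r)
    rearrange = ℕ-Solver.solve-∀

  -- Filling the first `k` down-steps, where `2 k` is the surplus, brings the starting height to
  -- zero. The up-steps of the resulting Dyck path form a basis that contains all kept elements.
  greedy-independent : (A : Subset (2 ℕ.* n)) → Independent (upSteps (greedy A))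
  greedy-independent A with even-surplus A
  ... | k , _ , even
    with fill k (≡.subst (λ j → DyckFrom j (greedy A))
                         (≡.trans even (≡.cong (k ℕ.+_) (≡.sym (ℕ.+-identityʳ k))))
                         (greedy-dyck A))
  ...   | Q , d , A⊆Q = upSteps Q , (Q , DyckFrom⇒IsDyck d , ≡.refl) , A⊆Q

  independent⇒≤greedyRank : ∀ {A I} → I ⊆ A → Independent I → ∣ I ∣ ℕ.≤ greedyRank A
  independent⇒≤greedyRank {A} {I} I⊆A (_ , (Q , d , ≡.refl) , I⊆Q) =
    greedy-maximal I A (IsDyck⇒DyckFrom d) I⊆A I⊆Q

  rank≡greedyRank : ∀ A → rank A ≡ greedyRank A
  rank≡greedyRank A = ℕ.≤-antisym
    (rank-greatest (catalanMatroid n) independent⇒≤greedyRank)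
    (independent⇒≤rank (catalanMatroid n) (greedy-⊆ A) (greedy-independent A))

  -- A name for `⊤` that fixes its length.
  groundSet : Subset (2 ℕ.* n)
  groundSet = ⊤

  -- It is at most half the length, and at least the size `n` of a basis.
  greedyRank-groundSet : greedyRank groundSet ≡ n
  greedyRank-groundSet = ℕ.≤-antisym
    (let k , r+k≡n , _ = even-surplus groundSet
     in ≡.subst (greedyRank groundSet ℕ.≤_) r+k≡n (ℕ.m≤m+n _ k))
    (let _ , (P , isDyck , _) = basis-exists
         d = IsDyck⇒DyckFrom isDyck
         twice = ≡.trans (≡.cong (∣ upSteps P ∣ ℕ.+_) (ℕ.+-identityʳ _)) (DyckFrom-size d)
     in ≡.subst (ℕ._≤ greedyRank groundSet) (ℕ.*-cancelˡ-≡ _ _ 2 twice)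
          (greedy-maximal (upSteps P) groundSet d ⊆⊤ id))

  -- The `k` of `even-surplus` is the corank, the exponent of `q - 1` in the Tutte polynomial.
  surplus≡2*corank : ∀ A → surplus A ≡ (rank groundSet ∸ rank A) ℕ.+ (rank groundSet ∸ rank A)
  surplus≡2*corank A with even-surplus A
  ... | k , r+k≡n , even = ≡.trans even (≡.cong (λ j → j ℕ.+ j) (≡.sym (begin
    rank groundSet ∸ rank A              ≡⟨ ≡.cong₂ _∸_ rank-groundSet (rank≡greedyRank A) ⟩
    n ∸ greedyRank A                     ≡⟨ ≡.cong (_∸ greedyRank A) r+k≡n ⟨
    (greedyRank A ℕ.+ k) ∸ greedyRank A  ≡⟨ ℕ.m+n∸m≡n (greedyRank A) k ⟩
    k                                    ∎)))
    where
    open ≡.≡-Reasoning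
    rank-groundSet : rank groundSet ≡ n
    rank-groundSet = ≡.trans (rank≡greedyRank groundSet) greedyRank-groundSet

  nullity≡∣A∣∸rank : ∀ A → nullity A ≡ ∣ A ∣ ∸ rank A
  nullity≡∣A∣∸rank A = begin
    nullity A                                    ≡⟨ ℕ.m+n∸m≡n (greedyRank A) (nullity A) ⟨
    (greedyRank A ℕ.+ nullity A) ∸ greedyRank A  ≡⟨ ≡.cong₂ _∸_ (greedyRank+nullity A)
                                                               (≡.sym (rank≡greedyRank A)) ⟩
    ∣ A ∣ ∸ rank A                               ∎
    where open ≡.≡-Reasoning

-- Returns to height 0

-- An arbitrary function is allowed so that the heights of a path can be compared with those of its
-- tail, started at another height.
zeros : (Fin m → ℤ) → ℕ
zeros f = List.length (List.filter (λ i → f i ℤ.≟ 0ℤ) (List.allFin _))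

length-filter-zeros-map : {I J : Set} (k : J → I) {f : I → ℤ} {g : J → ℤ} →
  f ∘ k ≗ g → ∀ xs →
  List.length (List.filter (λ i → f i ℤ.≟ 0ℤ) (List.map k xs)) ≡
  List.length (List.filter (λ j → g j ℤ.≟ 0ℤ) xs)
length-filter-zeros-map k         fk≗g []       = ≡.refl
length-filter-zeros-map k {f} {g} fk≗g (x ∷ xs) with f (k x) | fk≗g x
... | _ | ≡.refl with g x ℤ.≟ 0ℤ
...   | yes _ = ≡.cong suc (length-filter-zeros-map k fk≗g xs)
...   | no  _ = length-filter-zeros-map k fk≗g xs

zeros-tail : {f : Fin (suc m) → ℤ} {g : Fin m → ℤ} → f ∘ suc ≗ g →
  List.length (List.filter (λ i → f i ℤ.≟ 0ℤ) (List.tabulate suc)) ≡ zeros g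
zeros-tail {f = f} eq = ≡.trans
  (≡.cong (List.length ∘ List.filter (λ i → f i ℤ.≟ 0ℤ)) (≡.sym (List.map-tabulate id suc)))
  (length-filter-zeros-map suc eq (List.allFin _))

zeros-≢0 : (f : Fin (suc m) → ℤ) {g : Fin m → ℤ} → f zero ≢ 0ℤ → f ∘ suc ≗ g →
           zeros f ≡ zeros g
zeros-≢0 f f0≢0 eq =
  ≡.trans (≡.cong List.length (List.filter-reject (λ i → f i ℤ.≟ 0ℤ) f0≢0)) (zeros-tail eq)

zeros-≡0 : (f : Fin (suc m) → ℤ) {g : Fin m → ℤ} → f zero ≡ 0ℤ → f ∘ suc ≗ g →
           zeros f ≡ suc (zeros g)
zeros-≡0 f f0≡0 eq =
  ≡.trans (≡.cong List.length (List.filter-accept (λ i → f i ℤ.≟ 0ℤ) f0≡0))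
          (≡.cong suc (zeros-tail eq))

level : ℕ → Path m → Fin m → ℤ
level h P i = + h ℤ.+ ht P (suc i)

returns : ℕ → Path m → ℕ
returns h P = zeros (level h P)

b≡returns : (P : Path m) → b P ≡ returns 0 P
b≡returns {m} P = ≡.trans
  (≡.cong (List.length ∘ List.filter (λ i → ht P (suc i) ℤ.≟ 0ℤ))
          (≡.sym (List.map-id (List.allFin m))))
  (length-filter-zeros-map id (λ i → ≡.sym (ℤ.+-identityˡ (ht P (suc i)))) (List.allFin m))

returns-up : ∀ h (P : Path m) → returns h (up ∷ P) ≡ returns (suc h) P
returns-up h P = zeros-≢0 (level h (up ∷ P))
  -- The sum `+ h ℤ.+ 1ℤ` is stuck on the variable `h`; `ascend` turns it into a visible successor.
  (λ e → contradiction (≡.trans (≡.sym (ascend (+ h) 0ℤ)) e) λ ())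
  (λ i → ascend (+ h) (ht P (suc i)))

-- The down-step itself reaches height zero; this return is the source of the factor `t` in
-- `descend`.
returns-down-1 : (P : Path m) → returns 1 (down ∷ P) ≡ suc (returns 0 P)
returns-down-1 P = zeros-≡0 (level 1 (down ∷ P)) ≡.refl (λ i → fall 0ℤ (ht P (suc i)))

returns-down-2+ : ∀ h (P : Path m) → returns (suc (suc h)) (down ∷ P) ≡ returns (suc h) P
returns-down-2+ h P = zeros-≢0 (level (suc (suc h)) (down ∷ P)) (λ ())
  (λ i → fall (+ suc h) (ht P (suc i)))

-- The common recurrence

module Summation {c ℓ : Level} (R : CommutativeRing c ℓ) where

  open CommutativeRing R hiding (zero)
  open CommutativeSemigroupProperties +-commutativeSemigroup using (interchange)
  open SetoidReasoning setoid

  private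
    variable
      i p : Level
      I : Set i
      f g : I → Carrier

  ∑ : List I → (I → Carrier) → Carrier
  ∑ xs f = List.foldr (λ x s → f x + s) 0# xs

  ∑-cong : ∀ (xs : List I) → (∀ x → f x ≈ g x) → ∑ xs f ≈ ∑ xs g
  ∑-cong []       f≈g = refl
  ∑-cong (x ∷ xs) f≈g = +-cong (f≈g x) (∑-cong xs f≈g)

  ∑-0 : ∀ (xs : List I) → ∑ xs (λ _ → 0#) ≈ 0#
  ∑-0 []       = refl
  ∑-0 (x ∷ xs) = trans (+-identityˡ _) (∑-0 xs)

  ∑-+ : ∀ (xs : List I) → ∑ xs (λ x → f x + g x) ≈ ∑ xs f + ∑ xs g
  ∑-+ []       = sym (+-identityˡ 0#)
  ∑-+ (x ∷ xs) = trans (+-congˡ (∑-+ xs)) (interchange _ _ _ _)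

  *-distribˡ-∑ : ∀ (xs : List I) x → x * ∑ xs f ≈ ∑ xs (λ y → x * f y)
  *-distribˡ-∑ []       x = zeroʳ x
  *-distribˡ-∑ (y ∷ xs) x = trans (distribˡ x _ _) (+-congˡ (*-distribˡ-∑ xs x))

  ∑-++ : ∀ (xs ys : List I) → ∑ (xs ++ ys) f ≈ ∑ xs f + ∑ ys f
  ∑-++ []       ys = sym (+-identityˡ _)
  ∑-++ (x ∷ xs) ys = trans (+-congˡ (∑-++ xs ys)) (sym (+-assoc _ _ _))

  ∑-map : ∀ {j} {J : Set j} (k : J → I) xs → ∑ (List.map k xs) f ≡ ∑ xs (λ x → f (k x))
  ∑-map k []       = ≡.refl
  ∑-map k (x ∷ xs) = ≡.cong (λ s → _ + s) (∑-map k xs)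

  -- Turns the sum over Dyck paths into one over all step sequences, which can be split by first
  -- step.
  ∑-filter : {P : Pred I p} (P? : Decidable P) →
    (∀ {x} → P x → f x ≈ g x) → (∀ {x} → ¬ P x → g x ≈ 0#) →
    ∀ xs → ∑ (List.filter P? xs) f ≈ ∑ xs g
  ∑-filter P? eq vanish []       = refl
  ∑-filter P? eq vanish (x ∷ xs) with P? x
  ... | yes Px = +-cong (eq Px) (∑-filter P? eq vanish xs)
  ... | no ¬Px = begin
    ∑ (List.filter P? xs) _  ≈⟨ ∑-filter P? eq vanish xs ⟩
    ∑ xs _                   ≈⟨ +-identityˡ _ ⟨
    0# + ∑ xs _              ≈⟨ +-congʳ (vanish ¬Px) ⟨
    _                        ∎

  -- The induction step shared by subsets and paths.
  ∑-vectors : ∀ {A : Set} (x y : A) m {f : Vec A (suc m) → Carrier} →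
    ∑ (vectors (x ∷ y ∷ []) (suc m)) f ≈
    ∑ (vectors (x ∷ y ∷ []) m) (λ v → f (x ∷ v) + f (y ∷ v))
  ∑-vectors x y m {f} = begin
    ∑ (List.map (x ∷_) vs ++ List.map (y ∷_) vs ++ []) f
      ≡⟨ ≡.cong (λ ys → ∑ (List.map (x ∷_) vs ++ ys) f) (List.++-identityʳ _) ⟩
    ∑ (List.map (x ∷_) vs ++ List.map (y ∷_) vs) f
      ≈⟨ ∑-++ (List.map (x ∷_) vs) _ ⟩
    ∑ (List.map (x ∷_) vs) f + ∑ (List.map (y ∷_) vs) f
      ≡⟨ ≡.cong₂ _+_ (∑-map _ vs) (∑-map _ vs) ⟩
    ∑ vs (λ v → f (x ∷ v)) + ∑ vs (λ v → f (y ∷ v))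
      ≈⟨ ∑-+ vs ⟨
    ∑ vs (λ v → f (x ∷ v) + f (y ∷ v))  ∎
    where vs = vectors (x ∷ y ∷ []) m

-- From surplus to height

module Recurrence {c ℓ : Level} (R : CommutativeRing c ℓ) (t : CommutativeRing.Carrier R) where

  open CommutativeRing R hiding (zero)
  open CommutativeSemigroupProperties *-commutativeSemigroup using (x∙yz≈y∙xz)
  open GroupProperties +-group using (//-rightDividesˡ)
  open Exp semiring using (_^_)
  open Summation R
  open SetoidReasoning setoid

  -- Weight of the paths that first step down from height h and whose
  -- continuations from height k have weight f k.
  descend : (ℕ → Carrier) → ℕ → Carrier
  descend f 0             = 0#
  descend f 1             = t * f 0
  descend f (suc (suc h)) = f (suc h)

  -- (q - 1)^j if k = h + 2 j, and 0 if there is no such j.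
  gapPower : Carrier → ℕ → ℕ → Carrier
  gapPower q zero    0             = 1#
  gapPower q zero    1             = 0#
  gapPower q zero    (suc (suc k)) = (q - 1#) * gapPower q zero k
  gapPower q (suc h) zero          = 0#
  gapPower q (suc h) (suc k)       = gapPower q h k

  -- q^a(P) t^b(P) if P leads from height h to 0 without going below 0, where
  -- b counts the returns, and 0 otherwise. After the first down-step only
  -- the returns count, which is the weight at q = 1.
  pathWeight : Carrier → ℕ → Path m → Carrier
  pathWeight q h []         = gapPower q h 0
  pathWeight q h (up ∷ P)   = q * pathWeight q (suc h) P
  pathWeight q h (down ∷ P) = descend (λ k → pathWeight 1# k P) h

  -- With `f = gapPower q 0` and ground set `[2n]`, this is the Tutte term of `A`.
  weigh : (ℕ → Carrier) → Subset m → Carrier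
  weigh f A = f (surplus A) * (t - 1#) ^ nullity A

  -- Effect of one newly read element on `f`. From surplus `suc k`, `inside` leads to `k` and
  -- `outside` to `suc (suc k)`. From zero both lead to `1`, with coefficients `t - 1` and `1`.
  transfer : (ℕ → Carrier) → ℕ → Carrier
  transfer f zero    = t * f 1
  transfer f (suc k) = f k + f (suc (suc k))

  descend-cong : ∀ {f g} h → (∀ k → f k ≈ g k) → descend f h ≈ descend g h
  descend-cong 0             f≈g = refl
  descend-cong 1             f≈g = *-congˡ (f≈g 0)
  descend-cong (suc (suc h)) f≈g = f≈g (suc h)

  ∑-descend : ∀ {I : Set} (xs : List I) (f : ℕ → I → Carrier) h →
    ∑ xs (λ x → descend (λ j → f j x) h) ≈ descend (λ j → ∑ xs (f j)) h
  ∑-descend xs f 0             = ∑-0 xs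
  ∑-descend xs f 1             = sym (*-distribˡ-∑ xs t)
  ∑-descend xs f (suc (suc h)) = refl

  x+[y-1]x≈yx : ∀ x y → x + (y - 1#) * x ≈ y * x
  x+[y-1]x≈yx x y = begin
    x + (y - 1#) * x       ≈⟨ +-comm _ _ ⟩
    (y - 1#) * x + x       ≈⟨ +-congˡ (*-identityˡ x) ⟨
    (y - 1#) * x + 1# * x  ≈⟨ distribʳ x _ _ ⟨
    ((y - 1#) + 1#) * x    ≈⟨ *-congʳ (//-rightDividesˡ 1# y) ⟩
    y * x                  ∎

  [1-1]x≈0 : ∀ x → (1# - 1#) * x ≈ 0#
  [1-1]x≈0 x = trans (*-congʳ (-‿inverseʳ 1#)) (zeroˡ x)

  gapPower-even : ∀ q k → gapPower q 0 (k ℕ.+ k) ≈ (q - 1#) ^ k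
  gapPower-even q zero    = refl
  gapPower-even q (suc k) rewrite ℕ.+-suc k k = *-congˡ (gapPower-even q k)

  -- `gapPower 1# h` is the indicator of `h`, since `(1 - 1)^j` vanishes for positive `j`. It
  -- supplies the case `h = k + 2`, which the multiple of `q - 1` misses.
  gapPower-+2 : ∀ q h k →
    gapPower q h (suc (suc k)) ≈ (q - 1#) * gapPower q h k + gapPower 1# h (suc (suc k))
  gapPower-+2 q 0 k = sym (trans (+-congˡ ([1-1]x≈0 _)) (+-identityʳ _))
  gapPower-+2 q 1 zero = sym (trans (+-identityʳ _) (zeroʳ _))
  gapPower-+2 q 2 zero = sym (trans (+-congʳ (zeroʳ _)) (+-identityˡ _))
  gapPower-+2 q (suc (suc (suc h))) zero =
    sym (trans (+-congʳ (zeroʳ _)) (+-identityˡ _))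
  gapPower-+2 q (suc h) (suc k) = gapPower-+2 q h k

  descend-gapPower-0 : ∀ q h → descend (λ j → gapPower 1# j 0) h ≈ t * gapPower q h 1
  descend-gapPower-0 q 0             = sym (zeroʳ t)
  descend-gapPower-0 q 1             = refl
  descend-gapPower-0 q (suc (suc h)) = sym (zeroʳ t)

  -- Both sides are the indicator of `h = k + 2`: a step down to a positive height is no return, so
  -- no `t` appears.
  descend-gapPower-suc : ∀ h k →
    descend (λ j → gapPower 1# j (suc k)) h ≈ gapPower 1# h (suc (suc k))
  descend-gapPower-suc 0             k             = sym ([1-1]x≈0 _)
  descend-gapPower-suc 1             zero          = zeroʳ t
  descend-gapPower-suc 1             (suc k)       = begin
    t * ((1# - 1#) * gapPower 1# 0 k)  ≈⟨ *-congˡ ([1-1]x≈0 _) ⟩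
    t * 0#                             ≈⟨ zeroʳ t ⟩
    0#                                 ≈⟨ [1-1]x≈0 _ ⟨
    (1# - 1#) * gapPower 1# 0 k        ∎
  descend-gapPower-suc (suc (suc h)) k             = refl

  -- Trades a scanning step, acting on the surplus `k`, for a first path step, acting on the height
  -- `h`. For positive surplus, the two neighbouring powers combine by `x + (q - 1) x = q x` into
  -- the up-step term, and the leftover indicator is the down-step term.
  transfer-gapPower : ∀ q h k →
    transfer (gapPower q h) k ≈
    q * gapPower q (suc h) k + descend (λ j → gapPower 1# j k) h
  transfer-gapPower q h zero = begin
    t * gapPower q h 1                             ≈⟨ descend-gapPower-0 q h ⟨
    descend (λ j → gapPower 1# j 0) h              ≈⟨ +-identityˡ _ ⟨
    0# + descend (λ j → gapPower 1# j 0) h         ≈⟨ +-congʳ (zeroʳ q) ⟨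
    q * 0# + descend (λ j → gapPower 1# j 0) h     ∎
  transfer-gapPower q h (suc k) = begin
    gapPower q h k + gapPower q h (suc (suc k))
      ≈⟨ +-congˡ (gapPower-+2 q h k) ⟩
    gapPower q h k + ((q - 1#) * gapPower q h k + gapPower 1# h (suc (suc k)))
      ≈⟨ +-assoc _ _ _ ⟨
    gapPower q h k + (q - 1#) * gapPower q h k + gapPower 1# h (suc (suc k))
      ≈⟨ +-cong (x+[y-1]x≈yx (gapPower q h k) q) (sym (descend-gapPower-suc h k)) ⟩
    q * gapPower q h k + descend (λ j → gapPower 1# j (suc k)) h  ∎

  weigh-∷ : ∀ f (A : Subset m) →
    weigh f (outside ∷ A) + weigh f (inside ∷ A) ≈ weigh (transfer f) A
  weigh-∷ f A with surplus A
  ... | suc k = trans (+-comm _ _) (sym (distribʳ _ _ _))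
  ... | zero  = begin
    f 1 * w + f 1 * ((t - 1#) * w)  ≈⟨ +-congˡ (x∙yz≈y∙xz _ _ _) ⟩
    f 1 * w + (t - 1#) * (f 1 * w)  ≈⟨ x+[y-1]x≈yx (f 1 * w) t ⟩
    t * (f 1 * w)                   ≈⟨ *-assoc _ _ _ ⟨
    t * f 1 * w                     ∎
    where w = (t - 1#) ^ nullity A

  weigh-descend : ∀ (f : ℕ → ℕ → Carrier) h (A : Subset m) →
    weigh (λ k → descend (λ j → f j k) h) A ≈ descend (λ j → weigh (f j) A) h
  weigh-descend f 0             A = zeroˡ _
  weigh-descend f 1             A = *-assoc _ _ _
  weigh-descend f (suc (suc h)) A = refl

  weigh-gapPower-∷ : ∀ q h (A : Subset m) →
    weigh (gapPower q h) (outside ∷ A) + weigh (gapPower q h) (inside ∷ A) ≈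
    q * weigh (gapPower q (suc h)) A + descend (λ j → weigh (gapPower 1# j) A) h
  weigh-gapPower-∷ q h A = begin
    weigh (gapPower q h) (outside ∷ A) + weigh (gapPower q h) (inside ∷ A)
      ≈⟨ weigh-∷ (gapPower q h) A ⟩
    weigh (transfer (gapPower q h)) A
      ≈⟨ *-congʳ (transfer-gapPower q h (surplus A)) ⟩
    weigh (λ k → q * gapPower q (suc h) k + descend (λ j → gapPower 1# j k) h) A
      ≈⟨ distribʳ _ _ _ ⟩
    weigh (λ k → q * gapPower q (suc h) k) A +
    weigh (λ k → descend (λ j → gapPower 1# j k) h) A
      ≈⟨ +-cong (*-assoc _ _ _) (weigh-descend (gapPower 1#) h A) ⟩
    q * weigh (gapPower q (suc h)) A + descend (λ j → weigh (gapPower 1# j) A) h ∎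

  paths : ∀ m → List (Path m)
  paths = vectors (up ∷ down ∷ [])

  -- Both `q` and `h` vary in the induction: an up-step raises `h`, and a down-step lowers it and
  -- replaces `q` by `1#`.
  ∑-weigh≈∑-pathWeight : ∀ m q h →
    ∑ (subsets m) (weigh (gapPower q h)) ≈ ∑ (paths m) (pathWeight q h)
  ∑-weigh≈∑-pathWeight zero    q h = +-congʳ (*-identityʳ _)
  ∑-weigh≈∑-pathWeight (suc m) q h = begin
    ∑ (subsets (suc m)) (weigh (gapPower q h))
      ≈⟨ ∑-vectors outside inside m ⟩
    ∑ As (λ A → weigh (gapPower q h) (outside ∷ A) + weigh (gapPower q h) (inside ∷ A))
      ≈⟨ ∑-cong As (weigh-gapPower-∷ q h) ⟩
    ∑ As (λ A → q * weigh (gapPower q (suc h)) A + descend (λ j → weigh (gapPower 1# j) A) h)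
      ≈⟨ ∑-linear As (weigh (gapPower q (suc h))) (λ j → weigh (gapPower 1# j)) ⟩
    q * ∑ As (weigh (gapPower q (suc h))) + descend (λ j → ∑ As (weigh (gapPower 1# j))) h
      ≈⟨ +-cong (*-congˡ (∑-weigh≈∑-pathWeight m q (suc h)))
                (descend-cong h (∑-weigh≈∑-pathWeight m 1#)) ⟩
    q * ∑ Ps (pathWeight q (suc h)) + descend (λ j → ∑ Ps (pathWeight 1# j)) h
      ≈⟨ ∑-linear Ps (pathWeight q (suc h)) (pathWeight 1#) ⟨
    ∑ Ps (λ P → q * pathWeight q (suc h) P + descend (λ j → pathWeight 1# j P) h)
      ≈⟨ ∑-vectors up down m ⟨
    ∑ (paths (suc m)) (pathWeight q h) ∎
    where
    As = subsets m
    Ps = paths m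

    ∑-linear : ∀ {I : Set} (xs : List I) (f : I → Carrier) (g : ℕ → I → Carrier) →
      ∑ xs (λ x → q * f x + descend (λ j → g j x) h) ≈
      q * ∑ xs f + descend (λ j → ∑ xs (g j)) h
    ∑-linear xs f g = trans (∑-+ xs) (+-cong (sym (*-distribˡ-∑ xs q)) (∑-descend xs g h))

-- Evaluation of the path weights

module PathWeight {c ℓ : Level} (R : CommutativeRing c ℓ) (t : CommutativeRing.Carrier R) where

  open CommutativeRing R hiding (zero)
  open Exp semiring using (_^_; ^-congʳ)
  open Recurrence R t
  open SetoidReasoning setoid

  1^n*x≈x : ∀ n x → 1# ^ n * x ≈ x
  1^n*x≈x zero    x = *-identityˡ x
  1^n*x≈x (suc n) x = trans (*-congʳ (*-identityˡ _)) (1^n*x≈x n x)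

  pathWeight-dyck : ∀ q {P : Path m} → DyckFrom h P →
                    pathWeight q h P ≈ q ^ a P * t ^ returns h P
  pathWeight-dyck q [] = sym (*-identityˡ 1#)
  pathWeight-dyck {h = h} q (up {P = P} d) = begin
    q * pathWeight q (suc h) P              ≈⟨ *-congˡ (pathWeight-dyck q d) ⟩
    q * (q ^ a P * t ^ returns (suc h) P)   ≈⟨ *-assoc _ _ _ ⟨
    q * q ^ a P * t ^ returns (suc h) P     ≈⟨ *-congˡ (^-congʳ t (returns-up h P)) ⟨
    q * q ^ a P * t ^ returns h (up ∷ P)    ∎
  pathWeight-dyck q (down {h = zero} {P = P} d) = begin
    t * pathWeight 1# 0 P                   ≈⟨ *-congˡ (pathWeight-dyck 1# d) ⟩
    -- The factor `1# ^ a P` disappears: up-steps after the first down-step do not enter `a`.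
    t * (1# ^ a P * t ^ returns 0 P)        ≈⟨ *-congˡ (1^n*x≈x (a P) _) ⟩
    t ^ suc (returns 0 P)                   ≈⟨ ^-congʳ t (returns-down-1 P) ⟨
    t ^ returns 1 (down ∷ P)                ≈⟨ *-identityˡ _ ⟨
    1# * t ^ returns 1 (down ∷ P)           ∎
  pathWeight-dyck q (down {h = suc h} {P = P} d) = begin
    pathWeight 1# (suc h) P                 ≈⟨ pathWeight-dyck 1# d ⟩
    1# ^ a P * t ^ returns (suc h) P        ≈⟨ 1^n*x≈x (a P) _ ⟩
    t ^ returns (suc h) P                   ≈⟨ ^-congʳ t (returns-down-2+ h P) ⟨
    t ^ returns (suc (suc h)) (down ∷ P)    ≈⟨ *-identityˡ _ ⟨
    1# * t ^ returns (suc (suc h)) (down ∷ P)  ∎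

  pathWeight-nonDyck : ∀ q h (P : Path m) → ¬ DyckFrom h P → pathWeight q h P ≈ 0#
  pathWeight-nonDyck q zero    []         ¬d = contradiction [] ¬d
  pathWeight-nonDyck q (suc h) []         ¬d = refl
  pathWeight-nonDyck q h       (up ∷ P)   ¬d =
    trans (*-congˡ (pathWeight-nonDyck q (suc h) P (¬d ∘ up))) (zeroʳ q)
  pathWeight-nonDyck q 0       (down ∷ P) ¬d = refl
  pathWeight-nonDyck q 1       (down ∷ P) ¬d =
    trans (*-congˡ (pathWeight-nonDyck 1# 0 P (¬d ∘ down))) (zeroʳ t)
  pathWeight-nonDyck q (suc (suc h)) (down ∷ P) ¬d = pathWeight-nonDyck 1# (suc h) P (¬d ∘ down)

theorem3p4 : (n : ℕ) → .{{_ : NonZero n}} →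
    let open ℤ[q,t] in
    tutte (catalanMatroid n) ≈ ∑ (dyckPaths (2 ℕ.* n)) (λ P → q ^ a P * t ^ b P)
theorem3p4 n = begin
  tutte (catalanMatroid n)
    ≈⟨ ∑-cong (subsets (2 ℕ.* n)) tutte-term ⟩
  ∑ (subsets (2 ℕ.* n)) (weigh (gapPower q 0))
    ≈⟨ ∑-weigh≈∑-pathWeight (2 ℕ.* n) q 0 ⟩
  ∑ (paths (2 ℕ.* n)) (pathWeight q 0)
    -- Paths outside `dyckPaths` have weight zero.
    ≈⟨ ∑-filter isDyck? dyck-term
         (λ {P} ¬d → pathWeight-nonDyck q 0 P (¬d ∘ DyckFrom⇒IsDyck)) (paths (2 ℕ.* n)) ⟨
  ∑ (dyckPaths (2 ℕ.* n)) (λ P → q ^ a P * t ^ b P)  ∎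
  where
  open ℤ[q,t] using (q; t)
  open CommutativeRing ℤ[q,t] hiding (zero)
  open Exp semiring using (_^_; ^-congʳ)
  open Summation ℤ[q,t]
  open Recurrence ℤ[q,t] t
  open PathWeight ℤ[q,t] t
  open SetoidReasoning setoid
  open Matroid (catalanMatroid n) using (rank)

  -- The surplus is twice the corank, and `gapPower q 0` at `k + k` is `(q - 1)^k`.
  tutte-term : ∀ A → (q - 1#) ^ (rank ⊤ ∸ rank A) * (t - 1#) ^ (∣ A ∣ ∸ rank A) ≈
                     weigh (gapPower q 0) A
  tutte-term A = *-cong
    (trans (sym (gapPower-even q (rank ⊤ ∸ rank A)))
           (reflexive (≡.cong (gapPower q 0) (≡.sym (surplus≡2*corank n A)))))
    (^-congʳ (t - 1#) (≡.sym (nullity≡∣A∣∸rank n A)))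

  dyck-term : ∀ {P : Path (2 ℕ.* n)} → IsDyck P → q ^ a P * t ^ b P ≈ pathWeight q 0 P
  dyck-term {P} d = trans (*-congˡ {x = q ^ a P} (^-congʳ t (b≡returns P)))
                          (sym (pathWeight-dyck q (IsDyck⇒DyckFrom d)))
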